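{- Let $\mathbf L=(L,\le,\wedge,\vee,0,1,\nu)$ be a bounded lattice with an antitone map $\nu$, and let $\mathbb V$ be one of the varieties $\mathbb M,\mathbb G,\mathbb{INV},\mathbb{DMA},\mathbb O,\mathbb{BA}$. If $\mathbf L\in\mathbb V$, then the full complex algebra $(\mathcal G(X),\subseteq,\bigcap,\bigvee,\emptyset,X,(\cdot)^*)$ of its canonical frame (which is a canonical extension of $\mathbf L$ with $(\cdot)^*$ the $\pi$-extension of $\nu$) also belongs to $\mathbb V$. Thus each of these varieties is closed under canonical extensions.
   Context: Varieties: $\mathbb M$: bounded lattices with antitone $\nu$, $\nu0=1$, $\nu(a\vee b)=\nu a\wedge\nu b$; $\mathbb G$: $\mathbb M$ plus $a\le\nu\nu a$; $\mathbb{INV}$: $\nu$ an antitone involution ($\nu\nu a=a$); $\mathbb{DMA}$: $\mathbb{INV}$ plus distributivity (De Morgan algebras); $\mathbb O$: $\mathbb{INV}$ plus $a\wedge\nu a=0$ (ortholattices); $\mathbb{BA}$: Boolean algebras with $\nu$ the complement. Canonical frame of $\mathbf L$: $X$ the proper filters, $Y$ the proper ideals, $x\parallel y$ iff $x\cap y\neq\emptyset$; $\widehat\nu(x)$ is the ideal generated by $\{\nu a:a\in x\}$; $yS_\vee x$ iff $\widehat\nu(x)\subseteq y$. For $U\subseteq X$, $U'=\{y:\forall x\in U\;x\parallel y\}$; for $V\subseteq Y$, $V'=\{x:\forall y\in V\;x\parallel y\}$; $\mathcal G(X)=\{A\subseteq X:A=A''\}$ with meets = intersections, joins $(\bigcup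 A_j)''$. $x\perp z$ iff $\forall y(yS_\vee z\Rightarrow x\parallel y)$; $A^*=\{x:\forall z\in A\;x\perp z\}$. -}

module Defs where

open import Algebra.Core using (Op₁)
open import Algebra.Definitions using (_DistributesOverˡ_)
open import Algebra.Lattice.Bundles using (RawLattice)
open import Algebra.Lattice.Morphism.Structures using (IsLatticeMonomorphism)
open import Algebra.Lattice.Structures using (IsBooleanAlgebra)
open import Axiom.ExcludedMiddle using (ExcludedMiddle)
open import Data.Empty using (⊥-elim)
open import Data.List.Base using (List; foldr)
open import Data.List.Relation.Unary.All using (All)
open import Data.Product using (Σ; ∃; ∃₂; _×_; _,_; proj₁; proj₂)
open import Data.Sum.Base using (inj₁; inj₂; [_,_]′)
open import Function.Base using (_∘_)
open import Level using (Level; suc; _⊔_; Lift; lift; lower)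
open import Relation.Binary.Definitions using (Antitonic₁)
open import Relation.Binary.Lattice using (BoundedLattice)
open import Relation.Nullary using (¬_; yes; no)
open import Relation.Unary using (Pred; _∈_; _⊆_; _≐_; _∩_; _∪_; _≬_; Universal)
open import Relation.Unary.Polymorphic using (∅; U)

private
  variable
    c ℓ₁ ℓ₂ d m₁ m₂ : Level

------------------------------------------------------------------------
-- Varieties of bounded lattices with a unary operation

data Variety : Set where
  𝕄 𝔾 𝕀ℕ𝕍 𝔻𝕄𝔸 𝕆 𝔹𝔸 : Variety

InVariety : Variety → (L : BoundedLattice c ℓ₁ ℓ₂) →
            Op₁ (BoundedLattice.Carrier L) → Set (c ⊔ ℓ₁ ⊔ ℓ₂)
InVariety 𝕄 L ν =
    Antitonic₁ _≤_ _≤_ ν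
  × ν ⊥ ≈ ⊤
  × (∀ a b → ν (a ∨ b) ≈ ν a ∧ ν b)
  where open BoundedLattice L
InVariety 𝔾 L ν = InVariety 𝕄 L ν × (∀ a → a ≤ ν (ν a))
  where open BoundedLattice L
InVariety 𝕀ℕ𝕍 L ν = Antitonic₁ _≤_ _≤_ ν × (∀ a → ν (ν a) ≈ a)
  where open BoundedLattice L
InVariety 𝔻𝕄𝔸 L ν = InVariety 𝕀ℕ𝕍 L ν × _DistributesOverˡ_ _≈_ _∧_ _∨_
  where open BoundedLattice L
InVariety 𝕆 L ν = InVariety 𝕀ℕ𝕍 L ν × (∀ a → a ∧ ν a ≈ ⊥)
  where open BoundedLattice L
InVariety 𝔹𝔸 L ν = Antitonic₁ _≤_ _≤_ ν × IsBooleanAlgebra _≈_ _∨_ _∧_ ν ⊤ ⊥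
  where open BoundedLattice L

------------------------------------------------------------------------
-- The canonical frame of a bounded lattice with a unary operation

module CanonicalFrame (L : BoundedLattice c ℓ₁ ℓ₂)
                      (ν : Op₁ (BoundedLattice.Carrier L)) where

  open BoundedLattice L renaming (⊤ to 𝟏; ⊥ to 𝟎)

  p : Level
  p = c ⊔ ℓ₁ ⊔ ℓ₂

  record IsFilter (F : Pred Carrier p) : Set p where
    field
      𝟏∈       : 𝟏 ∈ F
      ∧-closed : ∀ {a b} → a ∈ F → b ∈ F → a ∧ b ∈ F
      up       : ∀ {a b} → a ≤ b → a ∈ F → b ∈ F

  record IsIdeal (I : Pred Carrier p) : Set p where
    field
      𝟎∈       : 𝟎 ∈ I
      ∨-closed : ∀ {a b} → a ∈ I → b ∈ I → a ∨ b ∈ I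
      down     : ∀ {a b} → a ≤ b → b ∈ I → a ∈ I

  record X : Set (suc p) where
    field
      filter   : Pred Carrier p
      isFilter : IsFilter filter
      proper   : ¬ Universal filter
    open IsFilter isFilter public

  record Y : Set (suc p) where
    field
      ideal   : Pred Carrier p
      isIdeal : IsIdeal ideal
      proper  : ¬ Universal ideal
    open IsIdeal isIdeal public

  open X using (filter)
  open Y using (ideal)

  data IdealGeneratedBy (S : Pred Carrier p) : Pred Carrier p where
    gen  : ∀ {a} → a ∈ S → a ∈ IdealGeneratedBy S
    bot  : 𝟎 ∈ IdealGeneratedBy S
    join : ∀ {a b} → a ∈ IdealGeneratedBy S → b ∈ IdealGeneratedBy S →
           a ∨ b ∈ IdealGeneratedBy S
    down : ∀ {a b} → a ≤ b → b ∈ IdealGeneratedBy S → a ∈ IdealGeneratedBy S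

  ν̂ : X → Pred Carrier p
  ν̂ x = IdealGeneratedBy (λ b → ∃ λ a → a ∈ filter x × b ≈ ν a)

  infix 4 _∥_ _S∨_ _⊥_

  _∥_ : X → Y → Set p
  x ∥ y = filter x ≬ ideal y

  _S∨_ : Y → X → Set p
  y S∨ x = ν̂ x ⊆ ideal y

  _⊥_ : X → X → Set (suc p)
  x ⊥ z = ∀ y → y S∨ z → x ∥ y

  -- The two halves of the Galois connection induced by _∥_, both of which
  -- are written (·)′ on paper.
  infix 10 _′ _‵ _″

  _′ : Pred X (suc p) → Pred Y (suc p)
  (A ′) y = ∀ x → x ∈ A → x ∥ y

  _‵ : Pred Y (suc p) → Pred X (suc p)
  (V ‵) x = ∀ y → y ∈ V → x ∥ y

  _″ : Pred X (suc p) → Pred X (suc p)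
  A ″ = (A ′) ‵

  record 𝒢 : Set (suc (suc p)) where
    field
      set    : Pred X (suc p)
      stable : set ≐ set ″
  open 𝒢

  ″-extensive : ∀ A → A ⊆ A ″
  ″-extensive A {x} x∈ y y∈ = y∈ x x∈

  ‵-stable : ∀ V → V ‵ ≐ (V ‵) ″
  ‵-stable V = (λ {x} → ″-extensive (V ‵) {x})
             , (λ x∈ y y∈V → x∈ y (λ z z∈ → z∈ y y∈V))

  infixr 7 _⊓_
  infixr 6 _⊔ᴳ_

  _⊓_ : 𝒢 → 𝒢 → 𝒢
  A ⊓ B = record
    { set    = set A ∩ set B
    ; stable = (λ {x} → ″-extensive (set A ∩ set B) {x})
             , (λ {x} x∈ →
                  proj₂ (stable A) {x} (λ y y∈ → x∈ y (λ z → y∈ z ∘ proj₁))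
                , proj₂ (stable B) {x} (λ y y∈ → x∈ y (λ z → y∈ z ∘ proj₂)))
    }

  _⊔ᴳ_ : 𝒢 → 𝒢 → 𝒢
  A ⊔ᴳ B = record
    { set    = (set A ∪ set B) ″
    ; stable = ‵-stable ((set A ∪ set B) ′)
    }

  ⊤ᴳ : 𝒢
  ⊤ᴳ = record { set = U ; stable = (λ {x} → ″-extensive U {x}) , _ }

  -- ∅ is stable because a proper filter x never meets the ideal of elements
  -- below 𝟎, which is proper as soon as there is some such x.
  ⊥ᴳ : 𝒢
  ⊥ᴳ = record
    { set    = ∅
    ; stable = (λ ())
             , (λ {x} x∈ → let a , a∈x , a≤𝟎 = x∈ (↓𝟎 x) (λ _ ())
                           in ⊥-elim (X.proper x λ b →
                                X.up x (trans (lower a≤𝟎) (minimum b)) a∈x))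
    }
    where
    ↓𝟎 : X → Y
    ↓𝟎 x = record
      { ideal   = λ a → Lift p (a ≤ 𝟎)
      ; isIdeal = record
        { 𝟎∈       = lift refl
        ; ∨-closed = λ a≤ b≤ → lift (∨-least (lower a≤) (lower b≤))
        ; down     = λ a≤b b≤ → lift (trans a≤b (lower b≤))
        }
      ; proper  = λ all → X.proper x λ b →
          X.up x (trans (lower (all 𝟏)) (minimum b)) (X.𝟏∈ x)
      }

  infix 10 _*

  _* : 𝒢 → 𝒢
  A * = record
    { set    = A*
    ; stable = (λ {x} → ″-extensive A* {x})
             , (λ x∈ z z∈A y ySz → x∈ y (λ w w∈A* → w∈A* z z∈A y ySz))
    }
    where
    A* : Pred X (suc p)
    A* x = ∀ z → z ∈ set A → x ⊥ z

  fullComplexAlgebra : BoundedLattice (suc (suc p)) (suc p) (suc p)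
  fullComplexAlgebra = record
    { Carrier = 𝒢
    ; _≈_     = λ A B → set A ≐ set B
    ; _≤_     = λ A B → set A ⊆ set B
    ; _∨_     = _⊔ᴳ_
    ; _∧_     = _⊓_
    ; ⊤       = ⊤ᴳ
    ; ⊥       = ⊥ᴳ
    ; isBoundedLattice = record
      { isLattice = record
        { isPartialOrder = record
          { isPreorder = record
            { isEquivalence = record
              { refl  = (λ x∈ → x∈) , (λ x∈ → x∈)
              ; sym   = λ (f , g) → (λ {x} → g {x}) , (λ {x} → f {x})
              ; trans = λ (f , g) (h , k) →
                  (λ {x} → h {x} ∘ f {x}) , (λ {x} → g {x} ∘ k {x})
              }
            ; reflexive = λ (f , _) {x} → f {x}
            ; trans     = λ f g {x} → g {x} ∘ f {x}
            }
          ; antisym = λ f g → (λ {x} → f {x}) , (λ {x} → g {x})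
          }
        ; supremum = λ A B →
            (λ {x} x∈ y y∈ → y∈ x (inj₁ x∈))
          , (λ {x} x∈ y y∈ → y∈ x (inj₂ x∈))
          , (λ C f g {x} x∈ → proj₂ (stable C) {x} λ y y∈ →
               x∈ y (λ z → [ y∈ z ∘ f {z} , y∈ z ∘ g {z} ]′))
        ; infimum = λ A B →
            proj₁ , proj₂ , (λ C f g {x} x∈ → f {x} x∈ , g {x} x∈)
        }
      ; maximum = λ _ _ → _
      ; minimum = λ _ ()
      }
    }

  -- The representation a ↦ {x : a ∈ x}. Its value is Galois closed because
  -- the principal ideal of a is proper unless a = 𝟏, a case distinction that
  -- is not available constructively.
  η : ExcludedMiddle p → Carrier → 𝒢
  η em a = record
    { set    = ηa
    ; stable = (λ {x} → ″-extensive ηa {x}) , (λ {x} → closed {x})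
    }
    where
    ηa : Pred X (suc p)
    ηa x = Lift (suc p) (a ∈ filter x)

    closed : ηa ″ ⊆ ηa
    closed {x} x∈ with em {P = Lift p (𝟏 ≤ a)}
    ... | yes (lift 𝟏≤a) = lift (X.up x 𝟏≤a (X.𝟏∈ x))
    ... | no  𝟏≰a =
      let b , b∈x , b≤a = x∈ ↓a (λ z z∈ → a , lower z∈ , lift refl)
      in lift (X.up x (lower b≤a) b∈x)
      where
      ↓a : Y
      ↓a = record
        { ideal   = λ b → Lift p (b ≤ a)
        ; isIdeal = record
          { 𝟎∈       = lift (minimum a)
          ; ∨-closed = λ b≤ b′≤ → lift (∨-least (lower b≤) (lower b′≤))
          ; down     = λ b≤b′ b′≤ → lift (trans b≤b′ (lower b′≤))
          }
        ; proper  = λ all → 𝟏≰a (all 𝟏)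
        }

------------------------------------------------------------------------
-- Canonical extensions

-- Throughout, s is the universe level of the predicates that stand for
-- arbitrary subsets. Under excluded middle its choice is immaterial, as every
-- predicate is equivalent to one at any given level.

module _ (C : BoundedLattice d m₁ m₂) where

  open BoundedLattice C

  IsSupremum : ∀ {s} → Pred Carrier s → Carrier → Set (d ⊔ m₂ ⊔ s)
  IsSupremum S u = (∀ v → v ∈ S → v ≤ u) × (∀ w → (∀ v → v ∈ S → v ≤ w) → u ≤ w)

  IsInfimum : ∀ {s} → Pred Carrier s → Carrier → Set (d ⊔ m₂ ⊔ s)
  IsInfimum S u = (∀ v → v ∈ S → u ≤ v) × (∀ w → (∀ v → v ∈ S → w ≤ v) → w ≤ u)

  IsComplete : (s : Level) → Set (d ⊔ m₂ ⊔ suc s)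
  IsComplete s = ∀ (S : Pred Carrier s) → ∃ (IsSupremum S) × ∃ (IsInfimum S)

rawLattice : BoundedLattice c ℓ₁ ℓ₂ → RawLattice c ℓ₁
rawLattice L = record { Carrier = Carrier ; _≈_ = _≈_ ; _∧_ = _∧_ ; _∨_ = _∨_ }
  where open BoundedLattice L

module _ (s : Level)
         (L : BoundedLattice c ℓ₁ ℓ₂) (C : BoundedLattice d m₁ m₂)
         (e : BoundedLattice.Carrier L → BoundedLattice.Carrier C) where

  private
    module L = BoundedLattice L
    module C = BoundedLattice C

  image : ∀ {t} → Pred L.Carrier t → Pred C.Carrier (c ⊔ m₁ ⊔ t)
  image S u = ∃ λ a → a ∈ S × u C.≈ e a

  IsClosed : Pred C.Carrier (c ⊔ d ⊔ m₁ ⊔ m₂ ⊔ suc s)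
  IsClosed k = Σ (Pred L.Carrier s) λ S → IsInfimum C (image S) k

  IsOpen : Pred C.Carrier (c ⊔ d ⊔ m₁ ⊔ m₂ ⊔ suc s)
  IsOpen o = Σ (Pred L.Carrier s) λ S → IsSupremum C (image S) o

  record IsCanonicalExtension
    : Set (c ⊔ ℓ₁ ⊔ ℓ₂ ⊔ d ⊔ m₁ ⊔ m₂ ⊔ suc s) where
    field
      complete   : IsComplete C s
      embedding  : IsLatticeMonomorphism (rawLattice L) (rawLattice C) e
      ⊤-homo     : e L.⊤ C.≈ C.⊤
      ⊥-homo     : e L.⊥ C.≈ C.⊥
      -- Being a join of some set of closed elements is the same as being the
      -- join of all closed elements below; dually for open elements.
      denseJoin  : ∀ u → IsSupremum C (λ k → IsClosed k × k C.≤ u) u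
      denseMeet  : ∀ u → IsInfimum  C (λ o → IsOpen   o × u C.≤ o) u
      compact    : ∀ (S T : Pred L.Carrier s) {k o} →
                   IsInfimum C (image S) k → IsSupremum C (image T) o → k C.≤ o →
                   ∃₂ λ (as bs : List L.Carrier) → All S as × All T bs ×
                     foldr L._∧_ L.⊤ as L.≤ foldr L._∨_ L.⊥ bs

  -- f is the π-extension of ν:
  --   f u = ⋀ { ⋁ { e (ν a) : k ≤ e a ≤ o } : k closed, o open, k ≤ u ≤ o }.
  -- This form makes sense for any map; when ν is antitone, compactness makes
  -- the constraint a ≤ o redundant, so that f u = ⋀ over closed k ≤ u of
  -- ⋁ { e (ν a) : k ≤ e a }.
  Isπ-Extension : Op₁ L.Carrier → Op₁ C.Carrier →
                  Set (c ⊔ d ⊔ m₁ ⊔ m₂ ⊔ suc s)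
  Isπ-Extension ν f = ∀ u → IsInfimum C (approximants u) (f u)
    where
    approximants : C.Carrier → Pred C.Carrier _
    approximants u w = ∃₂ λ k o →
      IsClosed k × IsOpen o × k C.≤ u × u C.≤ o ×
      IsSupremum C (image′ k o) w
      where
      image′ : C.Carrier → C.Carrier → Pred C.Carrier _
      image′ k o v = ∃ λ a → k C.≤ e a × e a C.≤ o × v C.≈ e (ν a)

-- Let f be the π-extension of ν to a canonical extension C of L. For closed k put
-- N k = ⋁ { e (ν a) : k ≤ e a }; then f u is the meet of the N k over closed k ≤ u.
-- Compactness shows that, if ν turns finite joins into meets,
--   k ≤ f u  ⇔  u ≤ ⋁ { e a : k ≤ e (ν a) }    for closed k,
-- so f turns joins into meets, and u ≤ f (f u) follows from a ≤ ν (ν a). Involutivity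
-- is then a computation on open elements, complementation is compactness, and
-- distributivity comes from the analogous residuation of k ∧_ for closed k.
--
-- In the canonical frame, the sets {z : x ⊆ z} with x a filter are closed and
-- join-dense, and the sets {x : x ∥ y} with y an ideal are open and meet-dense.
-- Compactness holds because a filter and an ideal that do not meet are proper, hence
-- points of the frame at which an inclusion k ⊆ o would fail.
module Submission where

open import Algebra.Core using (Op₁)
open import Algebra.Definitions using (_DistributesOverˡ_)
open import Algebra.Lattice.Bundles using (BooleanAlgebra)
open import Algebra.Lattice.Morphism.Structures using (IsLatticeMonomorphism)
import Algebra.Lattice.Properties.BooleanAlgebra as BooleanAlgebraProperties
open import Algebra.Lattice.Structures using (IsBooleanAlgebra)
open import Algebra.Lattice.Structures.Biased
  using (isBooleanAlgebraʳ; isDistributiveLatticeʳʲᵐ)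
open import Axiom.ExcludedMiddle using (ExcludedMiddle)
open import Data.Empty using (⊥-elim)
open import Data.List.Base using (List; []; _∷_; _++_; foldr)
open import Data.List.Relation.Unary.All using (All; []; _∷_)
import Data.List.Relation.Unary.All as All
open import Data.List.Relation.Unary.All.Properties using (++⁺)
open import Data.Product using (∃; ∃₂; _×_; _,_; proj₁; proj₂)
open import Data.Sum.Base using (inj₁; inj₂)
open import Function.Base using (id; _∘_)
open import Level using (Level; Lift; lift; lower)
open import Relation.Binary.Definitions using (Antitonic₁)
open import Relation.Binary.Lattice using (BoundedLattice)
import Relation.Binary.Lattice.Properties.DistributiveLattice as DistributiveLatticeProperties
import Relation.Binary.Lattice.Properties.Lattice as LatticeProperties
import Relation.Binary.Lattice.Properties.MeetSemilattice as MeetSemilatticeProperties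
open import Relation.Nullary using (¬_; yes; no)
open import Relation.Nullary.Decidable using (True; toWitness; fromWitness)
open import Relation.Unary using (Pred; _∈_; _⊆_)
open import Defs

private
  variable
    c ℓ₁ ℓ₂ d m₁ m₂ t : Level

-- Under excluded middle a proposition of any level has an equivalent at level s,
-- so completeness and compactness apply to subsets of every level.
record Resize (em : ∀ {ℓ} → ExcludedMiddle ℓ) (s : Level) (P : Set t) : Set s where
  constructor resize
  field holds : True (em {P = P})

module _ {em : ∀ {ℓ} → ExcludedMiddle ℓ} {s : Level} {P : Set t} where

  shrink : P → Resize em s P
  shrink x = resize (fromWitness x)

  expand : Resize em s P → P
  expand (resize h) = toWitness h

-- Finite meets and joins over lists.

module _ (L : BoundedLattice c ℓ₁ ℓ₂) where

  open BoundedLattice L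

  JoinClosed : Pred Carrier t → Set _
  JoinClosed S = ⊥ ∈ S × (∀ {a b} → a ∈ S → b ∈ S → a ∨ b ∈ S)

  MeetClosed : Pred Carrier t → Set _
  MeetClosed S = ⊤ ∈ S × (∀ {a b} → a ∈ S → b ∈ S → a ∧ b ∈ S)

  foldr-∨-closed : {S : Pred Carrier t} {as : List Carrier} →
                   JoinClosed S → All S as → foldr _∨_ ⊥ as ∈ S
  foldr-∨-closed (⊥∈ , _)    []         = ⊥∈
  foldr-∨-closed jc@(_ , ∨∈) (a∈ ∷ as∈) = ∨∈ a∈ (foldr-∨-closed jc as∈)

  foldr-∧-closed : {S : Pred Carrier t} {as : List Carrier} →
                   MeetClosed S → All S as → foldr _∧_ ⊤ as ∈ S
  foldr-∧-closed (⊤∈ , _)    []         = ⊤∈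
  foldr-∧-closed mc@(_ , ∧∈) (a∈ ∷ as∈) = ∧∈ a∈ (foldr-∧-closed mc as∈)

  foldr-∨-++ : ∀ as bs → foldr _∨_ ⊥ as ∨ foldr _∨_ ⊥ bs ≤ foldr _∨_ ⊥ (as ++ bs)
  foldr-∨-++ []       bs = ∨-least (minimum _) refl
  foldr-∨-++ (a ∷ as) bs = ∨-least
    (∨-least (x≤x∨y _ _) (trans (trans (x≤x∨y _ _) (foldr-∨-++ as bs)) (y≤x∨y _ _)))
    (trans (trans (y≤x∨y _ _) (foldr-∨-++ as bs)) (y≤x∨y _ _))

  foldr-∧-++ : ∀ as bs → foldr _∧_ ⊤ (as ++ bs) ≤ foldr _∧_ ⊤ as ∧ foldr _∧_ ⊤ bs
  foldr-∧-++ []       bs = ∧-greatest (maximum _) refl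
  foldr-∧-++ (a ∷ as) bs = ∧-greatest
    (∧-greatest (x∧y≤x _ _) (trans (x∧y≤y _ _) (trans (foldr-∧-++ as bs) (x∧y≤x _ _))))
    (trans (x∧y≤y _ _) (trans (foldr-∧-++ as bs) (x∧y≤y _ _)))

-- Implications between the varieties.

module _ (L : BoundedLattice c ℓ₁ ℓ₂) {ν : Op₁ (BoundedLattice.Carrier L)} where

  open BoundedLattice L

  -- Such a `ν` is a Galois connection with itself: `b ≤ ν a` iff `a ≤ ν b`. Hence it turns finite
  -- joins into meets.
  galois⇒𝕄 : Antitonic₁ _≤_ _≤_ ν → (∀ a → a ≤ ν (ν a)) → InVariety 𝕄 L ν
  galois⇒𝕄 anti a≤ννa =
      anti
    , antisym (maximum _) (trans (a≤ννa ⊤) (anti (minimum _)))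
    , λ a b → antisym
        (∧-greatest (anti (x≤x∨y a b)) (anti (y≤x∨y a b)))
        (trans (a≤ννa _)
          (anti (∨-least (trans (a≤ννa a) (anti (x∧y≤x _ _)))
                         (trans (a≤ννa b) (anti (x∧y≤y _ _))))))

  𝕀ℕ𝕍⇒𝔾 : InVariety 𝕀ℕ𝕍 L ν → InVariety 𝔾 L ν
  𝕀ℕ𝕍⇒𝔾 (anti , νν≈) = galois⇒𝕄 anti a≤ννa , a≤ννa
    where
    a≤ννa : ∀ a → a ≤ ν (ν a)
    a≤ννa a = reflexive (Eq.sym (νν≈ a))

  𝔹𝔸⇒𝔻𝕄𝔸 : InVariety 𝔹𝔸 L ν → InVariety 𝔻𝕄𝔸 L ν
  𝔹𝔸⇒𝔻𝕄𝔸 (anti , isBA) = (anti , ¬-involutive) , ∧-distribˡ-∨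
    where
    booleanAlgebra : BooleanAlgebra _ _
    booleanAlgebra = record { isBooleanAlgebra = isBA }

    open BooleanAlgebraProperties booleanAlgebra using (¬-involutive)
    open IsBooleanAlgebra isBA using (∧-distribˡ-∨)

  𝔹𝔸⇒𝕆 : InVariety 𝔹𝔸 L ν → InVariety 𝕆 L ν
  𝔹𝔸⇒𝕆 ba@(_ , isBA) = proj₁ (𝔹𝔸⇒𝔻𝕄𝔸 ba) , IsBooleanAlgebra.∧-complementʳ isBA

  -- Reduces the Boolean case to two others. The remaining law `a ∨ ν a ≈ ⊤` is the image of
  -- `a ∧ ν a ≈ ⊥` under the involution.
  𝔻𝕄𝔸∧𝕆⇒𝔹𝔸 : InVariety 𝔻𝕄𝔸 L ν → InVariety 𝕆 L ν → InVariety 𝔹𝔸 L ν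
  𝔻𝕄𝔸∧𝕆⇒𝔹𝔸 ((anti , νν≈) , distrib) (inv , ∧-compl) =
    anti , isBooleanAlgebraʳ (record
      { isDistributiveLattice = isDistributiveLatticeʳʲᵐ (record
        { isLattice    = LatticeProperties.isAlgLattice lattice
        ; ∨-distribʳ-∧ = DistributiveLatticeProperties.∨-distribʳ-∧ (record
            { isDistributiveLattice = record
              { isLattice    = isLattice
              ; ∧-distribˡ-∨ = distrib
              }
            })
        })
      ; ∨-complementʳ = ∨-compl
      ; ∧-complementʳ = ∧-compl
      ; ¬-cong        = λ a≈b → antisym (anti (reflexive (Eq.sym a≈b)))
                                        (anti (reflexive a≈b))
      })
    where
    ν⊥≈⊤ : ν ⊥ ≈ ⊤
    ν⊥≈⊤ = proj₁ (proj₂ (proj₁ (𝕀ℕ𝕍⇒𝔾 inv)))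

    ∨-compl : ∀ a → a ∨ ν a ≈ ⊤
    ∨-compl a = antisym (maximum _)
      (trans (reflexive (Eq.sym ν⊥≈⊤))
        (trans (anti ν[a∨νa]≤⊥) (reflexive (νν≈ _))))
      where
      ν[a∨νa]≤⊥ : ν (a ∨ ν a) ≤ ⊥
      ν[a∨νa]≤⊥ = trans
        (∧-greatest (trans (anti (y≤x∨y _ _)) (reflexive (νν≈ a)))
                    (anti (x≤x∨y _ _)))
        (reflexive (∧-compl a))

  -- Supplies `ν ⊥ ≈ ⊤` for all six varieties; the identification of `_*` as a π-extension uses it.
  InVariety⇒𝕄 : (𝕍 : Variety) → InVariety 𝕍 L ν → InVariety 𝕄 L ν
  InVariety⇒𝕄 𝕄   = id
  InVariety⇒𝕄 𝔾   = proj₁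
  InVariety⇒𝕄 𝕀ℕ𝕍 = proj₁ ∘ 𝕀ℕ𝕍⇒𝔾
  InVariety⇒𝕄 𝔻𝕄𝔸 = proj₁ ∘ 𝕀ℕ𝕍⇒𝔾 ∘ proj₁
  InVariety⇒𝕄 𝕆   = proj₁ ∘ 𝕀ℕ𝕍⇒𝔾 ∘ proj₁
  InVariety⇒𝕄 𝔹𝔸  = proj₁ ∘ 𝕀ℕ𝕍⇒𝔾 ∘ proj₁ ∘ 𝔹𝔸⇒𝔻𝕄𝔸

-- Closed and open elements of a canonical extension; compactness.

module CanonicalExtension
  (em : ∀ {ℓ} → ExcludedMiddle ℓ) (s : Level)
  (L : BoundedLattice c ℓ₁ ℓ₂) (C : BoundedLattice d m₁ m₂)
  (e : BoundedLattice.Carrier L → BoundedLattice.Carrier C)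
  (isCanonicalExtension : IsCanonicalExtension s L C e) where

  open IsCanonicalExtension isCanonicalExtension
  open IsLatticeMonomorphism embedding using (⟦⟧-cong; ∧-homo; ∨-homo; injective)

  private
    module L where
      open BoundedLattice L public
      open MeetSemilatticeProperties meetSemilattice public using (∧-monotonic)

  open BoundedLattice C
  open MeetSemilatticeProperties meetSemilattice using (∧-monotonic)

  private
    variable
      S T : Pred L.Carrier t
      a b : L.Carrier
      k l o u v w : Carrier

  Closed Open : Pred Carrier _
  Closed = IsClosed s L C e
  Open   = IsOpen s L C e

  e-mono : a L.≤ b → e a ≤ e b
  e-mono {a} {b} a≤b = trans (x≤x∨y (e a) (e b)) (reflexive
    (Eq.trans (Eq.sym (∨-homo a b))
              (⟦⟧-cong (L.antisym (L.∨-least a≤b L.refl) (L.y≤x∨y a b)))))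

  join-dense : (∀ {k} → Closed k → k ≤ u → k ≤ w) → u ≤ w
  join-dense h = proj₂ (denseJoin _) _ λ _ (k-closed , k≤u) → h k-closed k≤u

  meet-dense : (∀ {o} → Open o → u ≤ o → w ≤ o) → w ≤ u
  meet-dense h = proj₂ (denseMeet _) _ λ _ (o-open , u≤o) → h o-open u≤o

  ⋁ : Pred L.Carrier t → Carrier
  ⋁ S = proj₁ (proj₁ (complete λ u → Resize em s (u ∈ image s L C e S)))

  ⋁-upper : a ∈ S → e a ≤ ⋁ S
  ⋁-upper {S = S} a∈ =
    proj₁ (proj₂ (proj₁ (complete λ u → Resize em s (u ∈ image s L C e S))))
      _ (shrink (_ , a∈ , Eq.refl))

  ⋁-least : (∀ {a} → a ∈ S → e a ≤ w) → ⋁ S ≤ w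
  ⋁-least {S = S} h =
    proj₂ (proj₂ (proj₁ (complete λ u → Resize em s (u ∈ image s L C e S)))) _
      λ v v∈ → let _ , a∈ , v≈ = expand v∈ in trans (reflexive v≈) (h a∈)

  ⋁-isOpen : (S : Pred L.Carrier t) → Open (⋁ S)
  ⋁-isOpen S = (λ a → Resize em s (a ∈ S))
    , (λ v (_ , a∈ , v≈) → trans (reflexive v≈) (⋁-upper (expand a∈)))
    , (λ w h → ⋁-least λ a∈ → h _ (_ , shrink a∈ , Eq.refl))

  ⋀ : Pred L.Carrier t → Carrier
  ⋀ S = proj₁ (proj₂ (complete λ u → Resize em s (u ∈ image s L C e S)))

  ⋀-lower : a ∈ S → ⋀ S ≤ e a
  ⋀-lower {S = S} a∈ =
    proj₁ (proj₂ (proj₂ (complete λ u → Resize em s (u ∈ image s L C e S))))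
      _ (shrink (_ , a∈ , Eq.refl))

  ⋀-greatest : (∀ {a} → a ∈ S → w ≤ e a) → w ≤ ⋀ S
  ⋀-greatest {S = S} h =
    proj₂ (proj₂ (proj₂ (complete λ u → Resize em s (u ∈ image s L C e S)))) _
      λ v v∈ → let _ , a∈ , v≈ = expand v∈ in trans (h a∈) (reflexive (Eq.sym v≈))

  ⋀-isClosed : (S : Pred L.Carrier t) → Closed (⋀ S)
  ⋀-isClosed S = (λ a → Resize em s (a ∈ S))
    , (λ v (_ , a∈ , v≈) → trans (⋀-lower (expand a∈)) (reflexive (Eq.sym v≈)))
    , (λ w h → ⋀-greatest λ a∈ → h _ (_ , shrink a∈ , Eq.refl))

  -- Every member `a` of a set witnessing that `k` is closed satisfies `k ≤ e a`, so `k` is also the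
  -- meet of all `e a` above it.
  ≤-closed : Closed k → (∀ {a} → k ≤ e a → w ≤ e a) → w ≤ k
  ≤-closed (S , lower-bound , greatest) h = greatest _ λ v v∈@(_ , _ , v≈) →
    trans (h (trans (lower-bound v v∈) (reflexive v≈))) (reflexive (Eq.sym v≈))

  open-≤ : Open o → (∀ {a} → e a ≤ o → e a ≤ w) → o ≤ w
  open-≤ (S , upper-bound , least) h = least _ λ v v∈@(_ , _ , v≈) →
    trans (reflexive v≈) (h (trans (reflexive (Eq.sym v≈)) (upper-bound v v∈)))

  e-closed : ∀ a → Closed (e a)
  e-closed a = (λ b → Resize em s (a L.≤ b))
    , (λ v (_ , a≤b , v≈) → trans (e-mono (expand a≤b)) (reflexive (Eq.sym v≈)))
    , (λ w h → h _ (_ , shrink L.refl , Eq.refl))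

  e-open : ∀ a → Open (e a)
  e-open a = (λ b → Resize em s (b L.≤ a))
    , (λ v (_ , b≤a , v≈) → trans (reflexive v≈) (e-mono (expand b≤a)))
    , (λ w h → h _ (_ , shrink L.refl , Eq.refl))

  ⊥≤e : e L.⊥ ≤ u
  ⊥≤e = trans (reflexive ⊥-homo) (minimum _)

  ≤e⊤ : u ≤ e L.⊤
  ≤e⊤ = trans (maximum _) (reflexive (Eq.sym ⊤-homo))

  ≤e-∧ : u ≤ e a → u ≤ e b → u ≤ e (a L.∧ b)
  ≤e-∧ ≤a ≤b = trans (∧-greatest ≤a ≤b) (reflexive (Eq.sym (∧-homo _ _)))

  e-∨≤ : e a ≤ u → e b ≤ u → e (a L.∨ b) ≤ u
  e-∨≤ a≤ b≤ = trans (reflexive (∨-homo _ _)) (∨-least a≤ b≤)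

  e-cancel : e a ≤ e b → a L.≤ b
  e-cancel {a} {b} ea≤eb = L.trans
    (L.reflexive (injective (antisym (≤e-∧ refl ea≤eb) (e-mono (L.x∧y≤x a b)))))
    (L.x∧y≤y a b)

  -- Compactness in the form used below: the finite join it provides stays in `S`, and the finite
  -- meet stays among the `a` with `k ≤ e a`.
  closed-≤⋁ : JoinClosed L S → Closed k → k ≤ ⋁ S → ∃ λ a → a ∈ S × k ≤ e a
  closed-≤⋁ {S = S} jc (T , inf) k≤ =
    let as , bs , as∈ , bs∈ , as≤bs =
          compact T _ inf (proj₂ (⋁-isOpen S)) k≤
    in _ , foldr-∨-closed L jc (All.map expand bs∈)
         , trans (foldr-∧-closed L (≤e⊤ , ≤e-∧)
                   (All.map (λ a∈ → proj₁ inf _ (_ , a∈ , Eq.refl)) as∈))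
                 (e-mono as≤bs)

  ⋀-≤open : MeetClosed L S → Open o → ⋀ S ≤ o → ∃ λ a → a ∈ S × e a ≤ o
  ⋀-≤open {S = S} mc (T , sup) ≤o =
    let as , bs , as∈ , bs∈ , as≤bs =
          compact _ T (proj₂ (⋀-isClosed S)) sup ≤o
    in _ , foldr-∧-closed L mc (All.map expand as∈)
         , trans (e-mono as≤bs)
                 (foldr-∨-closed L (⊥≤e , e-∨≤)
                   (All.map (λ b∈ → proj₁ sup _ (_ , b∈ , Eq.refl)) bs∈))

  -- `o` is the join of the ideal of all `a` with `e a ≤ o`, to which compactness applies.
  interpolate : Closed k → Open o → k ≤ o → ∃ λ a → k ≤ e a × e a ≤ o
  interpolate k-closed o-open k≤o =
    let a , a≤o , k≤a = closed-≤⋁ (⊥≤e , e-∨≤) k-closed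
          (trans k≤o (open-≤ o-open ⋁-upper))
    in a , k≤a , a≤o

  -- The filter `Above` has its meet below both `k` and `l`, as seen by pairing an element above one
  -- of them with `⊤` for the other. Compactness then finds a member below `o`.
  interpolate-∧ : Closed k → Closed l → Open o → k ∧ l ≤ o →
                  ∃₂ λ a b → k ≤ e a × l ≤ e b × e (a L.∧ b) ≤ o
  interpolate-∧ {k} {l} k-closed l-closed o-open k∧l≤o =
    let _ , (a , b , k≤a , l≤b , a∧b≤c) , c≤o =
          ⋀-≤open mc o-open (trans (∧-greatest
            (≤-closed k-closed λ k≤a →
              ⋀-lower (_ , _ , k≤a , ≤e⊤ , L.x∧y≤x _ _))
            (≤-closed l-closed λ l≤b →
              ⋀-lower (_ , _ , ≤e⊤ , l≤b , L.x∧y≤y _ _))) k∧l≤o)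
    in a , b , k≤a , l≤b , trans (e-mono a∧b≤c) c≤o
    where
    Above : Pred L.Carrier _
    Above x = ∃₂ λ a b → k ≤ e a × l ≤ e b × a L.∧ b L.≤ x

    mc : MeetClosed L Above
    mc = (_ , _ , ≤e⊤ , ≤e⊤ , L.maximum _)
       , λ (_ , _ , k≤a , l≤b , ≤x) (_ , _ , k≤a′ , l≤b′ , ≤x′) →
           _ , _ , ≤e-∧ k≤a k≤a′ , ≤e-∧ l≤b l≤b′ ,
           L.∧-greatest
             (L.trans (L.∧-monotonic (L.x∧y≤x _ _) (L.x∧y≤x _ _)) ≤x)
             (L.trans (L.∧-monotonic (L.x∧y≤y _ _) (L.x∧y≤y _ _)) ≤x′)

  -- For fixed closed k and open o, {v : k ∧ v ≤ o} is a principal ideal; this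
  -- residuation is what makes k ∧_ distribute over joins.
  module _ (distrib : _DistributesOverˡ_ L._≈_ L._∧_ L._∨_) where

    Residual : Carrier → Carrier → Pred L.Carrier _
    Residual k o a = k ∧ e a ≤ o

    -- Interpolation moves both inequalities into `L`. With the two bounds of `k` replaced by their
    -- meet `c ∧ c′`, `distrib` combines them.
    Residual-joinClosed : Closed k → Open o → JoinClosed L (Residual k o)
    Residual-joinClosed k-closed o-open =
        trans (x∧y≤y _ _) ⊥≤e
      , λ k∧a≤o k∧b≤o →
          let c  , a′ , k≤c  , a≤a′ , c∧a′≤o  = interpolate-∧ k-closed (e-closed _) o-open k∧a≤o
              c′ , b′ , k≤c′ , b≤b′ , c′∧b′≤o = interpolate-∧ k-closed (e-closed _) o-open k∧b≤o
          in trans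
               (∧-monotonic (≤e-∧ k≤c k≤c′)
                 (trans (reflexive (∨-homo _ _))
                   (∨-least (trans a≤a′ (e-mono (L.x≤x∨y a′ b′)))
                            (trans b≤b′ (e-mono (L.y≤x∨y a′ b′))))))
               (trans (reflexive (Eq.trans (Eq.sym (∧-homo _ _)) (⟦⟧-cong (distrib _ _ _))))
                 (e-∨≤
                   (trans (e-mono (L.∧-monotonic (L.x∧y≤x _ _) L.refl)) c∧a′≤o)
                   (trans (e-mono (L.∧-monotonic (L.x∧y≤y _ _) L.refl)) c′∧b′≤o)))

    ∧≤⇒≤residual : Closed k → Open o → k ∧ v ≤ o → v ≤ ⋁ (Residual k o)
    ∧≤⇒≤residual k-closed o-open k∧v≤o = join-dense λ l-closed l≤v →
      let a , b , k≤a , l≤b , a∧b≤o =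
            interpolate-∧ k-closed l-closed o-open
              (trans (∧-monotonic refl l≤v) k∧v≤o)
      in trans l≤b (⋁-upper (trans (∧-monotonic k≤a refl)
           (trans (reflexive (Eq.sym (∧-homo _ _))) a∧b≤o)))

    ≤residual⇒∧≤ : Closed k → Open o → v ≤ ⋁ (Residual k o) → k ∧ v ≤ o
    ≤residual⇒∧≤ k-closed o-open v≤ = join-dense λ l-closed l≤k∧v →
      let a , k∧a≤o , l≤a = closed-≤⋁ (Residual-joinClosed k-closed o-open) l-closed
            (trans l≤k∧v (trans (x∧y≤y _ _) v≤))
      in trans (∧-greatest (trans l≤k∧v (x∧y≤x _ _)) l≤a) k∧a≤o

    distributive : _DistributesOverˡ_ _≈_ _∧_ _∨_
    distributive u v w = antisym
      -- Testing against closed `k` and open `o` puts `k` in place of `u`, so residuation of closed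
      -- elements suffices.
      (join-dense λ k-closed k≤ → meet-dense λ o-open ≤o →
        let k≤u = trans k≤ (x∧y≤x _ _) in
        trans (∧-greatest refl (trans k≤ (x∧y≤y _ _)))
          (≤residual⇒∧≤ k-closed o-open (∨-least
            (∧≤⇒≤residual k-closed o-open
              (trans (∧-monotonic k≤u refl) (trans (x≤x∨y _ _) ≤o)))
            (∧≤⇒≤residual k-closed o-open
              (trans (∧-monotonic k≤u refl) (trans (y≤x∨y _ _) ≤o))))))
      (∨-least (∧-monotonic refl (x≤x∨y _ _)) (∧-monotonic refl (y≤x∨y _ _)))

  -- The down-closure of {ν a : k ≤ e a}: it has the same join in C, and is an
  -- ideal as soon as ν is antitone.
  Image : Op₁ L.Carrier → Carrier → Pred L.Carrier _
  Image ν k b = ∃ λ a → k ≤ e a × b L.≤ ν a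

  module _ (ν : Op₁ L.Carrier) (ν-anti : Antitonic₁ L._≤_ L._≤_ ν) where

    Image-joinClosed : ∀ k → JoinClosed L (Image ν k)
    Image-joinClosed k =
        (L.⊤ , ≤e⊤ , L.minimum _)
      , λ (_ , k≤a , b≤) (_ , k≤a′ , b′≤) →
          _ , ≤e-∧ k≤a k≤a′ ,
          L.∨-least (L.trans b≤ (ν-anti (L.x∧y≤x _ _)))
                    (L.trans b′≤ (ν-anti (L.x∧y≤y _ _)))

    -- Exhibits `⋁ (Image ν k)` as an approximant in the sense of `Isπ-Extension`, with `e ⊤` as the
    -- open bound.
    ⋁-Image-supremum : IsSupremum C
      (λ v → ∃ λ a → k ≤ e a × e a ≤ e L.⊤ × v ≈ e (ν a)) (⋁ (Image ν k))
    ⋁-Image-supremum =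
        (λ v (_ , k≤a , _ , v≈) → trans (reflexive v≈) (⋁-upper (_ , k≤a , L.refl)))
      , (λ w h → ⋁-least λ (_ , k≤a , b≤) →
           trans (e-mono b≤) (h _ (_ , k≤a , ≤e⊤ , Eq.refl)))

    -- Meeting `a′` with an interpolant `a` brings it below `o` and, `ν` being antitone, only
    -- enlarges its value; hence the open bound does not change the join.
    ⋁-Image-≤ : Closed k → Open o → k ≤ o →
      (∀ {a} → k ≤ e a → e a ≤ o → e (ν a) ≤ w) → ⋁ (Image ν k) ≤ w
    ⋁-Image-≤ k-closed o-open k≤o h =
      let a , k≤a , a≤o = interpolate k-closed o-open k≤o
      in ⋁-least λ (a′ , k≤a′ , b≤) →
           trans (e-mono (L.trans b≤ (ν-anti (L.x∧y≤x a′ a))))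
             (h (≤e-∧ k≤a′ k≤a) (trans (e-mono (L.x∧y≤y a′ a)) a≤o))

    -- The criterion, in terms of closed elements alone, by which `_*` will be recognised as the
    -- π-extension.
    isπ-extension : ∀ {f} →
      (∀ {u k} → Closed k → k ≤ u → f u ≤ ⋁ (Image ν k)) →
      (∀ {u w} → (∀ {k} → Closed k → k ≤ u → w ≤ ⋁ (Image ν k)) → w ≤ f u) →
      Isπ-Extension s L C e ν f
    isπ-extension lower-bound greatest u =
        (λ v (k , o , k-closed , o-open , k≤u , u≤o , upper , _) →
           trans (lower-bound k-closed k≤u)
             (⋁-Image-≤ k-closed o-open (trans k≤u u≤o) λ k≤a a≤o →
               upper _ (_ , k≤a , a≤o , Eq.refl)))
      , (λ w h → greatest λ k-closed k≤u →
           h _ ( _ , _ , k-closed , e-open L.⊤ , k≤u , ≤e⊤ , ⋁-Image-supremum))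

  -- Preservation of the varieties by π-extensions.

  module πExtension
    (ν : Op₁ L.Carrier) (f : Op₁ Carrier)
    (ν-anti : Antitonic₁ L._≤_ L._≤_ ν)
    (isπExtension : Isπ-Extension s L C e ν f) where

    f-≤ : Closed k → k ≤ u → f u ≤ ⋁ (Image ν k)
    f-≤ k-closed k≤u = proj₁ (isπExtension _) _
      ( _ , _ , k-closed , e-open L.⊤ , k≤u , ≤e⊤ , ⋁-Image-supremum ν ν-anti)

    ≤-f : (∀ {k} → Closed k → k ≤ u → w ≤ ⋁ (Image ν k)) → w ≤ f u
    ≤-f h = proj₂ (isπExtension _) _
      λ v (k , o , k-closed , o-open , k≤u , u≤o , upper , _) →
        trans (h k-closed k≤u)
          (⋁-Image-≤ ν ν-anti k-closed o-open (trans k≤u u≤o) λ k≤a a≤o →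
            upper _ (_ , k≤a , a≤o , Eq.refl))

    f-anti : Antitonic₁ _≤_ _≤_ f
    f-anti u≤v = ≤-f λ k-closed k≤u → f-≤ k-closed (trans k≤u u≤v)

    f-e : ∀ a → f (e a) ≈ e (ν a)
    f-e a = antisym
      (trans (f-≤ (e-closed a) refl)
        (⋁-least λ (_ , a≤b , ≤νb) → e-mono (L.trans ≤νb (ν-anti (e-cancel a≤b)))))
      (≤-f λ _ k≤a → ⋁-upper (_ , k≤a , L.refl))

    Preimage : Carrier → Pred L.Carrier _
    Preimage k a = k ≤ e (ν a)

    -- For closed `l ≤ u`, compactness turns `k ≤ ⋁ (Image ν l)` into a single `a` with `l ≤ e a`
    -- and `k ≤ e (ν a)`.
    ≤f⇒≤⋁ : Closed k → k ≤ f u → u ≤ ⋁ (Preimage k)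
    ≤f⇒≤⋁ k-closed k≤fu = join-dense λ l-closed l≤u →
      let b , (a , l≤a , b≤νa) , k≤b = closed-≤⋁ (Image-joinClosed ν ν-anti _) k-closed
            (trans k≤fu (f-≤ l-closed l≤u))
      in trans l≤a (⋁-upper (trans k≤b (e-mono b≤νa)))

    -- The equations of 𝕄 make `Preimage k` closed under finite joins, so each closed `l ≤ u` lies
    -- below `e a` for one of its members.
    ≤⋁⇒≤f : InVariety 𝕄 L ν → u ≤ ⋁ (Preimage k) → k ≤ f u
    ≤⋁⇒≤f {k = k} (_ , ν⊥≈⊤ , ν-∨) u≤ = ≤-f λ l-closed l≤u →
      let a , k≤νa , l≤a = closed-≤⋁ joinClosed l-closed (trans l≤u u≤)
      in trans k≤νa (⋁-upper (a , l≤a , L.refl))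
      where
      joinClosed : JoinClosed L (Preimage k)
      joinClosed = trans ≤e⊤ (e-mono (L.reflexive (L.Eq.sym ν⊥≈⊤)))
                 , λ k≤νa k≤νb → trans (≤e-∧ k≤νa k≤νb)
                                       (e-mono (L.reflexive (L.Eq.sym (ν-∨ _ _))))

    𝕄-preserved : InVariety 𝕄 L ν → InVariety 𝕄 C f
    𝕄-preserved 𝕄L@(_ , ν⊥≈⊤ , _) =
        f-anti
      , antisym (maximum _)
          (trans ≤e⊤
            (trans (e-mono (L.reflexive (L.Eq.sym ν⊥≈⊤)))
              (trans (reflexive (Eq.sym (f-e L.⊥))) (f-anti (minimum _)))))
      , λ u v → antisym
          (∧-greatest (f-anti (x≤x∨y u v)) (f-anti (y≤x∨y u v)))
          -- For closed `k` below `f u` and `f v`, both `u` and `v` lie below `⋁ (Preimage k)`,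
          -- hence so does their join.
          (join-dense λ k-closed k≤ → ≤⋁⇒≤f 𝕄L (∨-least
            (≤f⇒≤⋁ k-closed (trans k≤ (x∧y≤x _ _)))
            (≤f⇒≤⋁ k-closed (trans k≤ (x∧y≤y _ _)))))

    𝔾-preserved : InVariety 𝔾 L ν → InVariety 𝔾 C f
    𝔾-preserved (𝕄L , a≤ννa) = 𝕄-preserved 𝕄L , λ u →
      join-dense λ k-closed k≤u → ≤⋁⇒≤f 𝕄L
        -- From `k ≤ e a ≤ e (ν (ν a))` it follows that `ν a` belongs to `Preimage k`.
        (trans (f-≤ k-closed k≤u) (⋁-least λ (a , k≤a , b≤νa) →
          trans (e-mono b≤νa) (⋁-upper (trans k≤a (e-mono (a≤ννa a))))))

    𝕀ℕ𝕍-preserved : InVariety 𝕀ℕ𝕍 L ν → InVariety 𝕀ℕ𝕍 C f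
    𝕀ℕ𝕍-preserved inv@(_ , νν≈) =
        f-anti
      , λ u → antisym
          -- `f ∘ f` is monotone, so this inequality reduces to open elements.
          (meet-dense λ o-open u≤o → trans (f-anti (f-anti u≤o)) (ff≤ o-open))
          (proj₂ (𝔾-preserved 𝔾L) u)
      where
      𝔾L : InVariety 𝔾 L ν
      𝔾L = 𝕀ℕ𝕍⇒𝔾 L inv

      ν-∧ : ∀ a b → ν (a L.∧ b) L.≤ ν a L.∨ ν b
      ν-∧ a b = L.trans
        (ν-anti (L.∧-greatest
          (L.trans (ν-anti (L.x≤x∨y (ν a) (ν b))) (L.reflexive (νν≈ a)))
          (L.trans (ν-anti (L.y≤x∨y (ν a) (ν b))) (L.reflexive (νν≈ b)))))
        (L.reflexive (νν≈ _))

      -- f o is at least the closed element ⋀ { e a : e (ν a) ≤ o }, whose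
      -- image under f is in turn at most o.
      ff≤ : Open o → f (f o) ≤ o
      ff≤ {o} o-open = trans
        (f-anti (≤⋁⇒≤f (proj₁ 𝔾L) (open-≤ o-open λ a≤o →
          ⋁-upper (⋀-lower (trans (e-mono (L.reflexive (νν≈ _))) a≤o)))))
        (trans (f-≤ (⋀-isClosed Coimage) refl) (⋁-least λ (a , ≤a , b≤νa) →
          let c , νc≤o , c≤a = ⋀-≤open meetClosed (e-open a) ≤a
          in trans (e-mono (L.trans b≤νa (ν-anti (e-cancel c≤a)))) νc≤o))
        where
        Coimage : Pred L.Carrier _
        Coimage a = e (ν a) ≤ o

        meetClosed : MeetClosed L Coimage
        meetClosed =
            trans (e-mono (L.trans (ν-anti (L.maximum _)) (L.reflexive (νν≈ L.⊥)))) ⊥≤e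
          , λ νa≤o νb≤o → trans (e-mono (ν-∧ _ _)) (e-∨≤ νa≤o νb≤o)

    𝔻𝕄𝔸-preserved : InVariety 𝔻𝕄𝔸 L ν → InVariety 𝔻𝕄𝔸 C f
    𝔻𝕄𝔸-preserved (inv , distrib) = 𝕀ℕ𝕍-preserved inv , distributive distrib

    𝕆-preserved : InVariety 𝕆 L ν → InVariety 𝕆 C f
    𝕆-preserved (inv , a∧νa≈⊥) = 𝕀ℕ𝕍-preserved inv , λ u → antisym
      (join-dense λ k-closed k≤ →
        -- As `k` lies below both `u` and `f u`, it lies below `⋁ (Image ν k)`; compactness gives
        -- one `a` with `k` below `e a` and `e (ν a)`.
        let b , (a , k≤a , b≤νa) , k≤b = closed-≤⋁ (Image-joinClosed ν ν-anti _) k-closed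
              (trans k≤ (trans (x∧y≤y _ _) (f-≤ k-closed (trans k≤ (x∧y≤x _ _)))))
        in trans (≤e-∧ k≤a (trans k≤b (e-mono b≤νa)))
             (trans (e-mono (L.reflexive (a∧νa≈⊥ a))) ⊥≤e))
      (minimum _)

    preserved : (𝕍 : Variety) → InVariety 𝕍 L ν → InVariety 𝕍 C f
    preserved 𝕄   = 𝕄-preserved
    preserved 𝔾   = 𝔾-preserved
    preserved 𝕀ℕ𝕍 = 𝕀ℕ𝕍-preserved
    preserved 𝔻𝕄𝔸 = 𝔻𝕄𝔸-preserved
    preserved 𝕆   = 𝕆-preserved
    preserved 𝔹𝔸  ba = 𝔻𝕄𝔸∧𝕆⇒𝔹𝔸 C
      (𝔻𝕄𝔸-preserved (𝔹𝔸⇒𝔻𝕄𝔸 L ba)) (𝕆-preserved (𝔹𝔸⇒𝕆 L ba))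

-- The complex algebra of the canonical frame as a canonical extension.

module CanonicalFrameProperties
  (em : ∀ {ℓ} → ExcludedMiddle ℓ) (s : Level)
  (L : BoundedLattice c ℓ₁ ℓ₂) (ν : Op₁ (BoundedLattice.Carrier L)) where

  open BoundedLattice L renaming (⊤ to 𝟏; ⊥ to 𝟎)
  open CanonicalFrame L ν
  open X using (filter)
  open Y using (ideal)
  open 𝒢

  ↑ : ∀ a → ¬ a ≤ 𝟎 → X
  ↑ a a≰𝟎 = record
    { filter   = λ b → Lift p (a ≤ b)
    ; isFilter = record
      { 𝟏∈       = lift (maximum a)
      ; ∧-closed = λ a≤b a≤c → lift (∧-greatest (lower a≤b) (lower a≤c))
      ; up       = λ b≤c a≤b → lift (trans (lower a≤b) b≤c)
      }
    ; proper   = λ all → a≰𝟎 (lower (all 𝟎))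
    }

  -- The principal filter of `a` is the test point. It is improper only if `a ≤ 𝟎`, and then `a` is
  -- in every ideal.
  ∥-all⇒∈ : ∀ {a} y → (∀ x → a ∈ filter x → x ∥ y) → a ∈ ideal y
  ∥-all⇒∈ {a} y h with em {P = a ≤ 𝟎}
  ... | yes a≤𝟎 = Y.down y a≤𝟎 (Y.𝟎∈ y)
  ... | no  a≰𝟎 = let b , a≤b , b∈y = h (↑ a a≰𝟎) (lift refl)
                  in Y.down y (lower a≤b) b∈y

  set-up : ∀ A {x z} → filter x ⊆ filter z → x ∈ set A → z ∈ set A
  set-up A x⊆z x∈A = proj₂ (stable A) λ y y∈A′ →
    let a , a∈x , a∈y = y∈A′ _ x∈A in a , x⊆z a∈x , a∈y

  -- The intersection of the sets `η em a` over `a` in the filter; stability is inherited from them.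
  Γ : X → 𝒢
  Γ x = record
    { set    = Γx
    ; stable = (λ {z} → ″-extensive Γx {z})
             , λ {z} z∈ → lift λ {a} a∈x → lower (proj₂ (stable (η em a)) {z}
                 λ y y∈ → z∈ y λ w x⊆w → y∈ w (lift (lower x⊆w a∈x)))
    }
    where
    Γx : Pred X _
    Γx z = Lift _ (filter x ⊆ filter z)

  Δ : Y → 𝒢
  Δ y = record
    { set    = ∥y
    ; stable = (λ {x} → ″-extensive ∥y {x})
             , λ x∈ → lift (x∈ y λ z z∥y → lower z∥y)
    }
    where
    ∥y : Pred X _
    ∥y x = Lift _ (x ∥ y)

  private
    G = fullComplexAlgebra
    module G = BoundedLattice G

  ⋂ : Pred 𝒢 t → 𝒢
  ⋂ S = record
    { set    = ⋂S
    ; stable = (λ {x} → ″-extensive ⋂S {x})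
             , λ x∈ → shrink λ A A∈S → proj₂ (stable A) λ y y∈A′ →
                 x∈ y λ z z∈ → y∈A′ z (expand z∈ A A∈S)
    }
    where
    ⋂S : Pred X _
    ⋂S x = Resize em _ (∀ A → A ∈ S → x ∈ set A)

  ⋃ : Pred 𝒢 t → 𝒢
  ⋃ S = record { set = ⋃S ″ ; stable = ‵-stable (⋃S ′) }
    where
    ⋃S : Pred X _
    ⋃S x = Resize em _ (∃ λ A → A ∈ S × x ∈ set A)

  complete : IsComplete G s
  complete S = (⋃ S , (λ A A∈S x∈A y y∈ → y∈ _ (shrink (A , A∈S , x∈A)))
                    , (λ B h x∈ → proj₂ (stable B) λ y y∈B′ →
                         x∈ y λ z z∈ → let A , A∈S , z∈A = expand z∈
                                       in y∈B′ z (h A A∈S z∈A)))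
             , (⋂ S , (λ A A∈S x∈ → expand x∈ A A∈S)
                    , (λ B h x∈B → shrink λ A A∈S → h A A∈S x∈B))

  η-mono : ∀ {a b} → a ≤ b → η em a G.≤ η em b
  η-mono a≤b {x} a∈x = lift (X.up x a≤b (lower a∈x))

  η-cancel : ∀ {a b} → η em a G.≤ η em b → a ≤ b
  η-cancel {a} h with em {P = a ≤ 𝟎}
  ... | yes a≤𝟎 = trans a≤𝟎 (minimum _)
  ... | no  a≰𝟎 = lower (lower (h {↑ a a≰𝟎} (lift (lift refl))))

  embedding : IsLatticeMonomorphism (rawLattice L) (rawLattice G) (η em)
  embedding = record
    { isLatticeHomomorphism = record
      { isRelHomomorphism = record
        { cong = λ a≈b → (λ {x} → η-mono (reflexive a≈b) {x})
                       , (λ {x} → η-mono (reflexive (Eq.sym a≈b)) {x})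
        }
      ; ∧-homo = λ a b →
            (λ {x} a∧b∈x → η-mono (x∧y≤x a b) {x} a∧b∈x , η-mono (x∧y≤y a b) {x} a∧b∈x)
          , (λ {x} (a∈x , b∈x) → lift (X.∧-closed x (lower a∈x) (lower b∈x)))
      ; ∨-homo = λ a b →
            -- A `y` related to all points containing `a` or `b` contains both elements, so `a ∨ b`
            -- itself witnesses `x ∥ y`.
            (λ a∨b∈x y y∈ → _ , lower a∨b∈x , Y.∨-closed y
               (∥-all⇒∈ y λ z a∈z → y∈ z (inj₁ (lift a∈z)))
               (∥-all⇒∈ y λ z b∈z → y∈ z (inj₂ (lift b∈z))))
          , (λ {x} → G.∨-least {η em a} {η em b} {η em (a ∨ b)}
              (λ {z} → η-mono (x≤x∨y a b) {z}) (λ {z} → η-mono (y≤x∨y a b) {z}) {x})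
      }
    ; injective = λ (f , g) → antisym (η-cancel (λ {x} → f {x})) (η-cancel (λ {x} → g {x}))
    }

  Γ-closed : ∀ x → IsClosed s L G (η em) (Γ x)
  Γ-closed x = (λ a → Resize em s (a ∈ filter x))
    , (λ A (a , a∈x , A≈) x⊆z → proj₂ A≈ (lift (lower x⊆z (expand a∈x))))
    , (λ B h z∈B → lift λ a∈x → lower (h (η em _) (_ , shrink a∈x , G.Eq.refl {η em _}) z∈B))

  Δ-open : ∀ y → IsOpen s L G (η em) (Δ y)
  Δ-open y = (λ a → Resize em s (a ∈ ideal y))
    , (λ A (a , a∈y , A≈) x∈A → lift (a , lower (proj₁ A≈ x∈A) , expand a∈y))
    , (λ B h (lift (a , a∈x , a∈y)) →
         h (η em a) (a , shrink a∈y , G.Eq.refl {η em a}) (lift a∈x))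

  -- Without such lists, the filter `F` generated by `S` and the ideal `I` generated by `T` are
  -- proper. Then `F` is a point of `Γ F ≤ k ≤ o ≤ Δ I`, so `F` meets `I`, which yields the lists
  -- after all.
  compact : ∀ (S T : Pred Carrier s) {k o} →
    IsInfimum G (image s L G (η em) S) k → IsSupremum G (image s L G (η em) T) o →
    k G.≤ o → ∃₂ λ as bs → All S as × All T bs × foldr _∧_ 𝟏 as ≤ foldr _∨_ 𝟎 bs
  compact S T {k} {o} (_ , greatest) (_ , least) k≤o
    with em {P = ∃₂ λ as bs → All S as × All T bs × foldr _∧_ 𝟏 as ≤ foldr _∨_ 𝟎 bs}
  ... | yes found = found
  ... | no  ¬found =
    let a , a∈F , a∈I = lower (o≤∥I {F} (k≤o {F} (ΓF≤k {F} (lift id))))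
        as , as∈ , as≤a = expand a∈F
        bs , bs∈ , a≤bs = expand a∈I
    in ⊥-elim (¬found (as , bs , as∈ , bs∈ , trans as≤a a≤bs))
    where
    F : X
    F = record
      { filter   = λ a → Resize em p (∃ λ as → All S as × foldr _∧_ 𝟏 as ≤ a)
      ; isFilter = record
        { 𝟏∈       = shrink ([] , [] , refl)
        ; ∧-closed = λ a∈ b∈ →
            let as , as∈ , as≤a = expand a∈
                bs , bs∈ , bs≤b = expand b∈
            in shrink (as ++ bs , ++⁺ as∈ bs∈ , trans (foldr-∧-++ L as bs)
                 (∧-greatest (trans (x∧y≤x _ _) as≤a) (trans (x∧y≤y _ _) bs≤b)))
        ; up       = λ a≤b a∈ → let as , as∈ , as≤a = expand a∈
                                in shrink (as , as∈ , trans as≤a a≤b)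
        }
      ; proper   = λ all → let as , as∈ , as≤𝟎 = expand (all 𝟎)
                           in ¬found (as , [] , as∈ , [] , as≤𝟎)
      }

    I : Y
    I = record
      { ideal   = λ a → Resize em p (∃ λ bs → All T bs × a ≤ foldr _∨_ 𝟎 bs)
      ; isIdeal = record
        { 𝟎∈       = shrink ([] , [] , refl)
        ; ∨-closed = λ a∈ b∈ →
            let as , as∈ , a≤as = expand a∈
                bs , bs∈ , b≤bs = expand b∈
            in shrink (as ++ bs , ++⁺ as∈ bs∈ , trans
                 (∨-least (trans a≤as (x≤x∨y _ _)) (trans b≤bs (y≤x∨y _ _)))
                 (foldr-∨-++ L as bs))
        ; down     = λ a≤b b∈ → let bs , bs∈ , b≤bs = expand b∈
                                in shrink (bs , bs∈ , trans a≤b b≤bs)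
        }
      ; proper  = λ all → let bs , bs∈ , 𝟏≤bs = expand (all 𝟏)
                          in ¬found ([] , bs , [] , bs∈ , 𝟏≤bs)
      }

    ΓF≤k : Γ F G.≤ k
    ΓF≤k = greatest (Γ F) λ A (a , a∈S , A≈) F⊆z →
      proj₂ A≈ (lift (lower F⊆z (shrink (a ∷ [] , a∈S ∷ [] , x∧y≤x _ _))))

    o≤∥I : o G.≤ Δ I
    o≤∥I = least (Δ I) λ A (a , a∈T , A≈) a∈z →
      lift (a , lower (proj₁ A≈ a∈z) , shrink (a ∷ [] , a∈T ∷ [] , x≤x∨y _ _))

  isCanonicalExtension : IsCanonicalExtension s L G (η em)
  isCanonicalExtension = record
    { complete  = complete
    ; embedding = embedding
    ; ⊤-homo    = _ , λ {x} _ → lift (X.𝟏∈ x)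
    ; ⊥-homo    = (λ {x} 𝟎∈x → ⊥-elim (X.proper x λ b → X.up x (minimum b) (lower 𝟎∈x)))
                , λ ()
    ; denseJoin = λ A →
        (λ k (_ , k≤A) → k≤A)
      , (λ B h {x} x∈A →
           h (Γ x) (Γ-closed x , λ x⊆z → set-up A (lower x⊆z) x∈A) (lift id))
    ; denseMeet = λ A →
        (λ o (_ , A≤o) → A≤o)
      , (λ B h x∈B → proj₂ (stable A) λ y y∈A′ →
           lower (h (Δ y) (Δ-open y , λ z∈A → lift (y∈A′ _ z∈A)) x∈B))
    ; compact   = compact
    }

  -- The operation `_*` as the π-extension of `ν`.

  open CanonicalExtension em s L G (η em) isCanonicalExtension
    using (⋁; ⋁-upper; ⋁-least; ≤-closed; ≤e⊤; ≤e-∧; Closed; Image; isπ-extension)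

  ν̂-least : ∀ x y → (∀ {a} → a ∈ filter x → ν a ∈ ideal y) → y S∨ x
  ν̂-least x y h (gen (a , a∈x , b≈νa)) = Y.down y (reflexive b≈νa) (h a∈x)
  ν̂-least x y h bot                    = Y.𝟎∈ y
  ν̂-least x y h (join a∈ b∈)           = Y.∨-closed y (ν̂-least x y h a∈) (ν̂-least x y h b∈)
  ν̂-least x y h (down a≤b b∈)          = Y.down y a≤b (ν̂-least x y h b∈)

  -- The set of `x` with `x ⊥ z` is `⋁ (Image ν (Γ z))`, so `A *` is the meet of these joins over
  -- the points `z` of `A`. It remains to pass from points to arbitrary closed `k ≤ A`.
  *-isπ-extension : Antitonic₁ _≤_ _≤_ ν → 𝟏 ≤ ν 𝟎 → Isπ-Extension s L G (η em) ν _*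
  *-isπ-extension ν-anti 𝟏≤ν𝟎 = isπ-extension ν ν-anti {f = _*}
    (λ {A} {k} k-closed k≤A {x} → *≤ A k k-closed k≤A {x})
    (λ {A} {B} h {x} x∈B z z∈A y ySz →
       -- Bounding the join by the open element `Δ y` gives exactly `x ∥ y`.
       lower (⋁-least {S = Image ν (Γ z)} {w = Δ y}
         (λ (a , Γz≤a , b≤νa) {w} b∈w → lift (_ , lower b∈w , Y.down y b≤νa
            (ySz (gen (a , lower (Γz≤a {z} (lift id)) , Eq.refl)))))
         {x}
         (h {Γ z} (Γ-closed z) (λ {w} z⊆w → set-up A {z} {w} (lower z⊆w) z∈A) {x} x∈B)))
    where
    *≤ : ∀ A k → Closed k → k G.≤ A → A * G.≤ ⋁ (Image ν k)
    *≤ A k k-closed k≤A {x} x∈A* =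
      proj₂ (stable (⋁ (Image ν k))) {x} λ y y∈ → x∥ y (νa∈ y y∈)
      where
      νa∈ : ∀ y → y ∈ set (⋁ (Image ν k)) ′ →
            ∀ {a} → k G.≤ η em a → ν a ∈ ideal y
      νa∈ y y∈ k≤a = ∥-all⇒∈ y λ z νa∈z →
        y∈ z (⋁-upper {S = Image ν k} (_ , k≤a , refl) {z} (lift νa∈z))

      x∥ : ∀ y → (∀ {a} → k G.≤ η em a → ν a ∈ ideal y) → x ∥ y
      x∥ y νa∈y with em {P = k G.≤ η em 𝟎}
      -- Here `a` may be `𝟎`, which puts `ν 𝟎`, and with it `𝟏`, into the ideal of `y`.
      ... | yes k≤𝟎 = 𝟏 , X.𝟏∈ x , Y.down y 𝟏≤ν𝟎 (νa∈y k≤𝟎)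
      ... | no  k≰𝟎 = x∈A* F F∈A y (ν̂-least F y λ a∈F → νa∈y (expand a∈F))
        where
        F : X
        F = record
          { filter   = λ a → Resize em p (k G.≤ η em a)
          ; isFilter = record
            { 𝟏∈       = shrink (≤e⊤ {u = k})
            ; ∧-closed = λ a∈ b∈ → shrink (≤e-∧ {u = k} (expand a∈) (expand b∈))
            ; up       = λ a≤b a∈ → shrink λ {z} z∈k → η-mono a≤b {z} (expand a∈ z∈k)
            }
          ; proper   = λ all → k≰𝟎 (expand (all 𝟎))
          }

        -- `F` lies in every `η em a` above `k`, hence in their meet `k`; so `x ⊥ F` is available.
        F∈A : F ∈ set A
        F∈A = k≤A {F} (≤-closed {k = k} {w = Γ F} k-closed
          (λ k≤a {z} F⊆z → lift (lower F⊆z (shrink k≤a))) {F} (lift id))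

theorem5p4 : ∀ {c ℓ₁ ℓ₂ d m₁ m₂ : Level} (s : Level) →
    (em : ∀ {ℓ} → ExcludedMiddle ℓ) →
    (𝕍 : Variety) →
    (L : BoundedLattice c ℓ₁ ℓ₂) →
    (ν : Op₁ (BoundedLattice.Carrier L)) →
    Antitonic₁ (BoundedLattice._≤_ L) (BoundedLattice._≤_ L) ν →
    InVariety 𝕍 L ν →
    let open CanonicalFrame L ν in
    InVariety 𝕍 fullComplexAlgebra _*
    × IsCanonicalExtension s L fullComplexAlgebra (η em)
    × Isπ-Extension s L fullComplexAlgebra (η em) ν _*
    × (∀ (C : BoundedLattice d m₁ m₂)
    (e : BoundedLattice.Carrier L → BoundedLattice.Carrier C)
    (f : Op₁ (BoundedLattice.Carrier C)) →
    IsCanonicalExtension s L C e →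
    Isπ-Extension s L C e ν f →
    InVariety 𝕍 C f)
theorem5p4 s em 𝕍 L ν ν-anti L∈𝕍 =
    closed fullComplexAlgebra (η em) _* isCanonicalExtension *-isπ
  , isCanonicalExtension
  , *-isπ
  , closed
  where
  open CanonicalFrame L ν
  open CanonicalFrameProperties em s L ν

  𝟏≤ν𝟎 : BoundedLattice._≤_ L (BoundedLattice.⊤ L) (ν (BoundedLattice.⊥ L))
  𝟏≤ν𝟎 = let _ , ν𝟎≈𝟏 , _ = InVariety⇒𝕄 L 𝕍 L∈𝕍 in reflexive (Eq.sym ν𝟎≈𝟏)
    where open BoundedLattice L using (reflexive; module Eq)

  *-isπ : Isπ-Extension s L fullComplexAlgebra (η em) ν _*
  *-isπ = *-isπ-extension ν-anti 𝟏≤ν𝟎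

  -- Has levels of its own because it serves twice: for arbitrary `C`, and for the full complex
  -- algebra, whose levels are determined by `L`.
  closed : ∀ {d m₁ m₂} (C : BoundedLattice d m₁ m₂)
    (e : BoundedLattice.Carrier L → BoundedLattice.Carrier C)
    (f : Op₁ (BoundedLattice.Carrier C)) →
    IsCanonicalExtension s L C e → Isπ-Extension s L C e ν f → InVariety 𝕍 C f
  closed C e f C-ext f-ext =
    CanonicalExtension.πExtension.preserved em s L C e C-ext ν f ν-anti f-ext 𝕍 L∈𝕍
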